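{- Let $r$ and $g$ be positive integers with $r\le 5$, and let $k=rg$. Let $R$ be a connected graph with pairwise distinct vertices $u_1,\dots,u_{rg}$ and an automorphism $\psi$ such that $\psi(u_i)=u_{i+1}$ for all $i$ (indices modulo $rg$). Let $W_0$ be a loopless graph, vertex-disjoint from $R$, containing disjoint sets $V_1=\{w_i:i\in[rg]\}$ of $rg$ distinct vertices and $V_2=\{x_i:i\in[r]\}$ of $r$ distinct vertices (indices of $w$ modulo $rg$, indices of $x$ modulo $r$; $V_1\cup V_2$ may be a proper subset of $V(W_0)$), and suppose $W_0$ has two automorphisms $\phi$ and $\rho$ such that: (1) $\phi(w_i)=w_{i+g}$ for all $i\in[rg]$ and $\phi(x_i)=x_{i+1}$ for all $i\in[r]$; (2) for some $c\in[rg]$, $\rho(w_{1+s})=w_{c-s}$ for all integers $0\le s\le rg-1$, and for some $c'\in[r]$, $\rho(x_{1+i})=x_{c'-i}$ for all integers $0\le i\le r-1$. Let $Y$ be an arbitrary graph, vertex-disjoint from $R$ and $W_0$, with pairwise distinct vertices $y_1,\dots,y_r$, and let $W=W_0(x_1,\dots,x_r)\sqcup Y(y_1,\dots,y_r)$. Then $R(u_1,\dots,u_{rg})\sqcup W(w_1,\dots,w_{rg})$ and $R(u_{rg},\dots,u_1)\sqcup W(w_1,\dots,w_{rg})$ are $T$-equivalent.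
   Context: Graphs may have loops and parallel edges; $[m]=\{1,\dots,m\}$. The Tutte polynomial of $G=(V,E)$ is $T_G(x,y)=\sum_{A\subseteq E}(x-1)^{r(E)-r(A)}(y-1)^{|A|-r(A)}$ with $r(A)=|V|-c(A)$, $c(A)$ the number of components of $(V,A)$; two graphs are $T$-equivalent if they have the same Tutte polynomial. For vertex-disjoint graphs $G,W$ with distinct vertices $a_1,\dots,a_k\in V(G)$ and distinct $b_1,\dots,b_k\in V(W)$, $G(a_1,\dots,a_k)\sqcup W(b_1,\dots,b_k)$ is obtained from $G$ and $W$ by identifying $a_i$ with $b_i$ into a single vertex for every $i$. -}

module Defs where

open import Data.Nat using (ℕ; zero; suc; _+_; _∸_; _<?_; NonZero)
open import Data.Nat.Combinatorics using (_C_)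
open import Data.Nat.DivMod using (_mod_)
open import Data.Integer as ℤ using (ℤ)
open import Data.Fin using (Fin; zero; suc; toℕ; _≟_)
open import Data.Bool using (Bool; true; false; _∨_; _∧_; not; if_then_else_)
open import Data.Vec using (Vec; []; _∷_; lookup; replicate)
open import Data.Product using (_×_; _,_; proj₁; proj₂; Σ; ∃; map; swap)
open import Data.Sum using (_⊎_; inj₁; inj₂; [_,_])
open import Data.Empty using (⊥)
open import Function using (_∘_)
open import Function.Definitions using (Injective)
open import Relation.Nullary.Decidable using (⌊_⌋)
open import Relation.Binary.PropositionalEquality using (_≡_)

-- Finite multigraphs (loops and parallel edges allowed).
-- Vertices: Fin nV, edges: Fin nE, each edge has two ends
-- (the order of the ends is irrelevant for every notion below).

record Graph : Set where
  field
    nV   : ℕ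
    nE   : ℕ
    ends : Fin nE → Fin nV × Fin nV
open Graph public

V : Graph → Set
V G = Fin (nV G)

E : Graph → Set
E G = Fin (nE G)

eqF : ∀ {n} → Fin n → Fin n → Bool
eqF a b = ⌊ a ≟ b ⌋

anyF : ∀ n → (Fin n → Bool) → Bool
anyF zero    f = false
anyF (suc n) f = f zero ∨ anyF n (f ∘ suc)

countF : ∀ n → (Fin n → Bool) → ℕ
countF zero    f = 0
countF (suc n) f = (if f zero then 1 else 0) + countF n (f ∘ suc)

iter : {X : Set} → ℕ → (X → X) → X → X
iter zero    f x = x
iter (suc n) f x = f (iter n f x)

EdgeSet : Graph → Set
EdgeSet G = Vec Bool (nE G)

fullE : (G : Graph) → EdgeSet G
fullE G = replicate (nE G) true

size : (G : Graph) → EdgeSet G → ℕ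
size G A = countF (nE G) (lookup A)

step : (G : Graph) → EdgeSet G → (V G → Bool) → (V G → Bool)
step G A S v = S v ∨ anyF (nE G) (λ e → lookup A e ∧
                 ((S (proj₁ (ends G e)) ∧ eqF (proj₂ (ends G e)) v) ∨
                  (S (proj₂ (ends G e)) ∧ eqF (proj₁ (ends G e)) v)))

-- reachable G A u v = true  iff  u and v are joined by a walk using edges of A
-- (walks of length ≤ |V| suffice, so |V| search steps are enough)
reachable : (G : Graph) → EdgeSet G → V G → V G → Bool
reachable G A u v = iter (nV G) (step G A) (eqF u) v

-- c(A): number of connected components of (V, A)
-- (= number of vertices that are the least vertex of their component)
ncomp : (G : Graph) → EdgeSet G → ℕ
ncomp G A = countF (nV G) (λ v → not (anyF (nV G) (λ u →
              ⌊ toℕ u <? toℕ v ⌋ ∧ reachable G A u v)))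

Connected : Graph → Set
Connected G = ∀ u v → reachable G (fullE G) u v ≡ true

-- Tutte polynomial, as its coefficient function:
--   tutte G i j = coefficient of x^i y^j in
--   T_G(x,y) = Σ_{A⊆E} (x-1)^{r(E)-r(A)} (y-1)^{|A|-r(A)},  r(A) = |V| - c(A).
-- Here r(E)-r(A) = c(A) - c(E) and |A|-r(A) = |A| + c(A) - |V|, both ≥ 0.

sgn : ℕ → ℤ
sgn zero    = ℤ.+ 1
sgn (suc n) = ℤ.- sgn n

-- coefficient of x^i in (x-1)^a
coeffPow : ℕ → ℕ → ℤ
coeffPow a i = sgn (a ∸ i) ℤ.* ℤ.+ (a C i)

sumSub : ∀ m → (Vec Bool m → ℤ) → ℤ
sumSub zero    f = f []
sumSub (suc m) f = sumSub m (λ A → f (true ∷ A)) ℤ.+ sumSub m (λ A → f (false ∷ A))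

tutte : Graph → ℕ → ℕ → ℤ
tutte G i j = sumSub (nE G) (λ A →
  coeffPow (ncomp G A ∸ ncomp G (fullE G)) i ℤ.*
  coeffPow ((size G A + ncomp G A) ∸ nV G) j)

TEquivalent : Graph → Graph → Set
TEquivalent G H = ∀ i j → tutte G i j ≡ tutte H i j

record Automorphism (G : Graph) : Set where
  field
    σ      : V G → V G
    σ⁻¹    : V G → V G
    σσ⁻¹   : ∀ v → σ (σ⁻¹ v) ≡ v
    σ⁻¹σ   : ∀ v → σ⁻¹ (σ v) ≡ v
    τ      : E G → E G
    τ⁻¹    : E G → E G
    ττ⁻¹   : ∀ e → τ (τ⁻¹ e) ≡ e
    τ⁻¹τ   : ∀ e → τ⁻¹ (τ e) ≡ e
    compat : ∀ e → ends G (τ e) ≡ map σ σ (ends G e)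
                 ⊎ ends G (τ e) ≡ swap (map σ σ (ends G e))
open Automorphism public

Loopless : Graph → Set
Loopless G = ∀ e → proj₁ (ends G e) ≡ proj₂ (ends G e) → ⊥

-- H is (isomorphic to) G(a_1,…,a_k) ⊔ W(b_1,…,b_k):
-- H is the disjoint union of G and W with a_i identified with b_i.
-- Concretely: injective vertex embeddings ιG, ιW into H, jointly surjective,
-- whose images meet exactly in the identified pairs (a_i = b_i), and an edge
-- bijection E(G) ⊎ E(W) ≅ E(H) respecting ends.

record IsGluing (G : Graph) (k : ℕ) (a : Fin k → V G)
                (W : Graph) (b : Fin k → V W) (H : Graph) : Set where
  field
    ιG      : V G → V H
    ιW      : V W → V H
    ιG-inj  : Injective _≡_ _≡_ ιG
    ιW-inj  : Injective _≡_ _≡_ ιW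
    glue    : ∀ i → ιG (a i) ≡ ιW (b i)
    only    : ∀ v w → ιG v ≡ ιW w → ∃ λ i → v ≡ a i × w ≡ b i
    cover   : ∀ h → (∃ λ v → ιG v ≡ h) ⊎ (∃ λ w → ιW w ≡ h)
    εG      : E G → E H
    εW      : E W → E H
    εinv    : E H → E G ⊎ E W
    εinv-G  : ∀ e → εinv (εG e) ≡ inj₁ e
    εinv-W  : ∀ e → εinv (εW e) ≡ inj₂ e
    ε-surj  : ∀ f → [ εG , εW ] (εinv f) ≡ f
    endsG   : ∀ e → ends H (εG e) ≡ map ιG ιG (ends G e)
    endsW   : ∀ e → ends H (εW e) ≡ map ιW ιW (ends W e)

-- cyclic index arithmetic on Fin k.  Indices are 0-based: the Agda index j
-- stands for the paper's index j+1.

_+ₘ_ : ∀ {k} → Fin k → ℕ → Fin k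
_+ₘ_ {suc k} j s = (toℕ j + s) mod (suc k)

reflectₘ : ∀ {k} → Fin k → Fin k → Fin k
reflectₘ {suc k} c s = (toℕ c + (suc k ∸ toℕ s)) mod (suc k)

{-# OPTIONS --safe #-}

-- Fix the part A_Y = A ∩ E(Y) of an edge set A.  It matters only through the
-- partition of y_1, …, y_r into components, and since r ≤ 5 this partition is
-- fixed by a reflection π of the r-gon.  Some β = φᵗρ induces π on the x_i and
-- a reflection w_i ↦ w_{c−i} on the w_i, so a power α of ψ satisfies
-- α(u_i) = u_{rg+1−j} whenever β(w_i) = w_j.  Apply α to the edges in R, β to
-- those in W₀ and fix A_Y: the components of the two spanning subgraphs then
-- correspond, where π permutes the components of (V(Y), A_Y) meeting the y_i.
-- The resulting bijection between edge sets of H₁ and H₂ preserves size and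
-- number of components, hence matches the Tutte sums term by term.

module Submission where

open import Defs
open import Data.Nat using (ℕ; zero; suc; _+_; _*_; _∸_; _≤_; _<_; _≤?_; _<?_; _%_; z≤n; s≤s)
open import Data.Nat.DivMod using (%-distribˡ-+; m%n%n≡m%n; [m+n]%n≡m%n; [m+kn]%n≡m%n; m<n⇒m%n≡m; m%n<n)
open import Data.Nat.Properties using (n≤1+n; +-suc; +-assoc; +-comm; +-identityʳ; *-identityʳ; ≤-refl; ≤-trans; ≤-antisym; <⇒≱; ≮⇒≥; m+[n∸m]≡n; m∸n+n≡m)
open import Data.Nat.Tactic.RingSolver using (solve-∀)
open import Data.Integer as ℤ using (ℤ)
import Data.Integer.Properties as ℤ
open import Data.Fin using (Fin; zero; suc; toℕ; opposite; splitAt; _↑ˡ_; _↑ʳ_; _≟_; punchOut)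
open import Data.Fin.Properties using (suc-injective; toℕ-injective; toℕ<n; toℕ≤pred[n]; toℕ-fromℕ<; opposite-prop; opposite-involutive; splitAt-↑ˡ; splitAt-↑ʳ; join-splitAt; any?; all?; injective⇒≤; punchOut-injective)
open import Data.Fin.Permutation using (permutation)
open import Data.Bool using (Bool; true; false; _∨_; _∧_; not; if_then_else_)
import Data.Bool.Properties as Bool
open import Data.Vec using (Vec; []; _∷_; lookup; tabulate; replicate)
open import Data.Vec.Properties using (lookup∘tabulate; tabulate∘lookup; tabulate-cong; lookup-replicate)
open import Data.Product using (∃; _×_; _,_; proj₁; proj₂; swap)
import Data.Product as Product
open import Data.Sum using (_⊎_; inj₁; inj₂; [_,_]; [_,_]′)
import Data.Sum as Sum
open import Data.Empty using (⊥; ⊥-elim)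
open import Data.Unit using (⊤; tt)
open import Function using (_∘_; id)
open import Function.Definitions using (Injective)
open import Level using (0ℓ)
open import Relation.Unary using (Pred; Decidable)
open import Relation.Nullary using (yes; no; contradiction)
open import Relation.Nullary.Decidable using (Dec; map′; toWitness; ⌊_⌋; _→-dec_; _×-dec_; ¬?)
open import Relation.Binary.Construct.Closure.Equivalence as Eq using (EqClosure)
open import Relation.Binary.Construct.Closure.ReflexiveTransitive using (ε; _◅_; _◅◅_)
open import Relation.Binary.Construct.Closure.Symmetric using (fwd; bwd)
open import Relation.Binary.PropositionalEquality using (_≡_; _≢_; _≗_; refl; sym; trans; cong; cong₂; subst; subst₂; module ≡-Reasoning)
open import Algebra.Properties.CommutativeMonoid.Sum ℤ.+-0-commutativeMonoid using (sum; sum-cong-≗; sum-permute)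

-- Booleans and counting

∨⁻ : ∀ a {b} → a ∨ b ≡ true → a ≡ true ⊎ b ≡ true
∨⁻ true  _ = inj₁ refl
∨⁻ false b = inj₂ b

∨⁺ˡ : ∀ {a} b → a ≡ true → a ∨ b ≡ true
∨⁺ˡ b refl = refl

∨⁺ʳ : ∀ a {b} → b ≡ true → a ∨ b ≡ true
∨⁺ʳ a refl = Bool.∨-zeroʳ a

∧⁻ : ∀ a {b} → a ∧ b ≡ true → a ≡ true × b ≡ true
∧⁻ true b = refl , b

∧⁺ : ∀ {a b} → a ≡ true → b ≡ true → a ∧ b ≡ true
∧⁺ refl refl = refl

⌊⌋⁺ : ∀ {P : Set} {P? : Dec P} → P → ⌊ P? ⌋ ≡ true
⌊⌋⁺ {P? = yes _} p = refl
⌊⌋⁺ {P? = no ¬p} p = contradiction p ¬p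

⌊⌋⁻ : ∀ {P : Set} {P? : Dec P} → ⌊ P? ⌋ ≡ true → P
⌊⌋⁻ {P? = yes p} _ = p

anyF⁺ : ∀ n (p : Fin n → Bool) i → p i ≡ true → anyF n p ≡ true
anyF⁺ (suc n) p zero    pi = ∨⁺ˡ _ pi
anyF⁺ (suc n) p (suc i) pi = ∨⁺ʳ (p zero) (anyF⁺ n (p ∘ suc) i pi)

anyF⁻ : ∀ n (p : Fin n → Bool) → anyF n p ≡ true → ∃ λ i → p i ≡ true
anyF⁻ (suc n) p any with ∨⁻ (p zero) any
... | inj₁ p0   = zero , p0
... | inj₂ rest = Product.map suc id (anyF⁻ n (p ∘ suc) rest)

countF-cong : ∀ n {p q : Fin n → Bool} → p ≗ q → countF n p ≡ countF n q
countF-cong zero    p≗q = refl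
countF-cong (suc n) p≗q =
  cong₂ _+_ (cong (if_then 1 else 0) (p≗q zero)) (countF-cong n (p≗q ∘ suc))

countF≤n : ∀ n (p : Fin n → Bool) → countF n p ≤ n
countF≤n zero    p = z≤n
countF≤n (suc n) p with p zero
... | true  = s≤s (countF≤n n (p ∘ suc))
... | false = ≤-trans (countF≤n n (p ∘ suc)) (n≤1+n n)

delete : ∀ {n} → Fin n → (Fin n → Bool) → (Fin n → Bool)
delete j q i = q i ∧ not (eqF j i)

delete⁺ : ∀ {n} {j i : Fin n} {q} → q i ≡ true → j ≢ i → delete j q i ≡ true
delete⁺ {j = j} {i} qi j≢i with j ≟ i
... | yes j≡i = contradiction j≡i j≢i
... | no  _   = ∧⁺ qi refl

countF-delete : ∀ n {q : Fin n → Bool} j → q j ≡ true →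
                countF n q ≡ suc (countF n (delete j q))
countF-delete n {q} j qj = go n q (delete j q) j qj deleted kept
  where
  deleted : delete j q j ≡ false
  deleted with j ≟ j
  ... | yes _  = Bool.∧-zeroʳ (q j)
  ... | no j≢j = contradiction refl j≢j

  kept : ∀ i → i ≢ j → q i ≡ delete j q i
  kept i i≢j with j ≟ i
  ... | yes j≡i = contradiction (sym j≡i) i≢j
  ... | no  _   = sym (Bool.∧-identityʳ (q i))

  go : ∀ n (p q : Fin n → Bool) j → p j ≡ true → q j ≡ false →
       (∀ i → i ≢ j → p i ≡ q i) → countF n p ≡ suc (countF n q)
  go (suc n) p q zero pj qj p≡q rewrite pj | qj =
    cong suc (countF-cong n (λ i → p≡q (suc i) λ ()))
  go (suc n) p q (suc j) pj qj p≡q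
    rewrite p≡q zero (λ ())
          | go n (p ∘ suc) (q ∘ suc) j pj qj (λ i i≢j → p≡q (suc i) (i≢j ∘ suc-injective))
    = +-suc _ _

-- Induction on `n`: once index `zero` has claimed `h zero`, that value is deleted from `q`, and
-- injectivity keeps all later values away from it.
countF-inj : ∀ {n m} (p : Fin n → Bool) (q : Fin m → Bool) (h : Fin n → Fin m) →
             (∀ i → p i ≡ true → q (h i) ≡ true) →
             (∀ i j → p i ≡ true → p j ≡ true → h i ≡ h j → i ≡ j) →
             countF n p ≤ countF m q
countF-inj {zero}      p q h hq inj = z≤n
countF-inj {suc n} {m} p q h hq inj with p zero in p0
... | false = countF-inj (p ∘ suc) q (h ∘ suc) (hq ∘ suc)
                (λ i j pi pj e → suc-injective (inj _ _ pi pj e))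
... | true  = subst (suc (countF n (p ∘ suc)) ≤_) (sym (countF-delete m (h zero) (hq zero p0)))
    (s≤s (countF-inj (p ∘ suc) (delete (h zero) q) (h ∘ suc)
      (λ i pi → delete⁺ {q = q} (hq (suc i) pi) (λ e → contradiction (inj _ _ p0 pi e) λ ()))
      (λ i j pi pj e → suc-injective (inj _ _ pi pj e))))

countF-⊂ : ∀ n (p q : Fin n → Bool) j → (∀ i → p i ≡ true → q i ≡ true) →
           q j ≡ true → p j ≢ true → countF n p < countF n q
countF-⊂ n p q j p⊆q qj ¬pj = subst (countF n p <_) (sym (countF-delete n j qj))
  (s≤s (countF-inj p (delete j q) id
    (λ i pi → delete⁺ {q = q} (p⊆q i pi) λ { refl → ¬pj pi })
    (λ _ _ _ _ e → e)))

-- Pigeonhole: a missed value `j` could be punched out of the codomain, leaving an injection from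
-- `Fin (suc n)` into `Fin n`.
inj⇒surj : ∀ {n} {f : Fin n → Fin n} → Injective _≡_ _≡_ f → ∀ j → ∃ λ i → f i ≡ j
inj⇒surj {suc n} {f} f-inj j with any? (λ i → f i ≟ j)
... | yes hit = hit
... | no miss = contradiction (injective⇒≤ avoid-inj) (<⇒≱ ≤-refl)
  where
  avoid : Fin (suc n) → Fin n
  avoid i = punchOut {i = j} {j = f i} (λ j≡fi → miss (i , sym j≡fi))

  avoid-inj : Injective _≡_ _≡_ avoid
  avoid-inj {a} {b} e = f-inj (punchOut-injective (λ j≡ → miss (a , sym j≡)) (λ j≡ → miss (b , sym j≡)) e)

-- Sums over subsets

-- This is 2^m, written as a sum so that `splitAt (card m)` separates the sets with the first
-- element from those without it, in the order of `sumSub`.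
card : ℕ → ℕ
card zero    = 1
card (suc m) = card m + card m

decode : ∀ m → Fin (card m) → Vec Bool m
decode zero    _ = []
decode (suc m) i = [ (true ∷_) ∘ decode m , (false ∷_) ∘ decode m ]′ (splitAt (card m) i)

encode : ∀ {m} → Vec Bool m → Fin (card m)
encode []              = zero
encode {suc m} (true  ∷ A) = encode A ↑ˡ card m
encode {suc m} (false ∷ A) = card m ↑ʳ encode A

decode-encode : ∀ {m} (A : Vec Bool m) → decode m (encode A) ≡ A
decode-encode []          = refl
decode-encode {suc m} (true ∷ A)
  rewrite splitAt-↑ˡ (card m) (encode A) (card m) = cong (true ∷_) (decode-encode A)
decode-encode {suc m} (false ∷ A)
  rewrite splitAt-↑ʳ (card m) (card m) (encode A) = cong (false ∷_) (decode-encode A)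

encode-decode : ∀ m i → encode (decode m i) ≡ i
encode-decode zero    zero = refl
encode-decode (suc m) i with splitAt (card m) i | join-splitAt (card m) (card m) i
... | inj₁ j | e = trans (cong (_↑ˡ card m) (encode-decode m j)) e
... | inj₂ j | e = trans (cong (card m ↑ʳ_) (encode-decode m j)) e

sum-↑ : ∀ m n (t : Fin (m + n) → ℤ) →
        sum t ≡ sum (t ∘ (_↑ˡ n)) ℤ.+ sum (t ∘ (m ↑ʳ_))
sum-↑ zero    n t = sym (ℤ.+-identityˡ _)
sum-↑ (suc m) n t = trans (cong (ℤ._+_ (t zero)) (sum-↑ m n (t ∘ suc))) (sym (ℤ.+-assoc (t zero) _ _))

sumSub≡sum : ∀ m f → sumSub m f ≡ sum (f ∘ decode m)
sumSub≡sum zero    f = sym (ℤ.+-identityʳ _)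
sumSub≡sum (suc m) f = sym (trans (sum-↑ (card m) (card m) _) (cong₂ ℤ._+_
  (trans (sum-cong-≗ (λ i → cong (f ∘ [ (true ∷_) ∘ decode m , (false ∷_) ∘ decode m ]′) (splitAt-↑ˡ (card m) i (card m))))
         (sym (sumSub≡sum m _)))
  (trans (sum-cong-≗ (λ i → cong (f ∘ [ (true ∷_) ∘ decode m , (false ∷_) ∘ decode m ]′) (splitAt-↑ʳ (card m) (card m) i)))
         (sym (sumSub≡sum m _)))))

sumSub-cong : ∀ m {f g : Vec Bool m → ℤ} → f ≗ g → sumSub m f ≡ sumSub m g
sumSub-cong zero    f≗g = f≗g []
sumSub-cong (suc m) f≗g =
  cong₂ ℤ._+_ (sumSub-cong m (f≗g ∘ (true ∷_))) (sumSub-cong m (f≗g ∘ (false ∷_)))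

-- Numbering the subsets by `encode` and `decode` turns the bijection into a permutation of indices,
-- under which a finite sum is invariant.
sumSub-reindex : ∀ {m n} (to : Vec Bool m → Vec Bool n) (from : Vec Bool n → Vec Bool m) →
                 (∀ B → to (from B) ≡ B) → (∀ A → from (to A) ≡ A) →
                 ∀ f → sumSub m (f ∘ to) ≡ sumSub n f
sumSub-reindex {m} {n} to from to-from from-to f = begin
  sumSub m (f ∘ to)                          ≡⟨ sumSub≡sum m _ ⟩
  sum (f ∘ to ∘ decode m)                    ≡⟨ sum-cong-≗ (λ i → cong f (decode-encode (to (decode m i)))) ⟨
  sum (f ∘ decode n ∘ encode ∘ to ∘ decode m) ≡⟨ sum-permute (f ∘ decode n) π ⟨
  sum (f ∘ decode n)                         ≡⟨ sumSub≡sum n f ⟨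
  sumSub n f                                 ∎
  where
  open ≡-Reasoning
  π = permutation (encode ∘ to ∘ decode m) (encode ∘ from ∘ decode n)
    (λ j → trans (cong (encode ∘ to) (decode-encode (from (decode n j))))
             (trans (cong encode (to-from (decode n j))) (encode-decode n j)))
    (λ i → trans (cong (encode ∘ from) (decode-encode (to (decode m i))))
             (trans (cong encode (from-to (decode m i))) (encode-decode m i)))

-- Connectivity

-- Each edge counts only in its stored direction; the equivalence closure in `Conn` adds the reverse
-- direction and the walks.
Adj : (G : Graph) → EdgeSet G → V G → V G → Set
Adj G A u v = ∃ λ e → lookup A e ≡ true × ends G e ≡ (u , v)

Conn : (G : Graph) → EdgeSet G → V G → V G → Set
Conn G A = EqClosure (Adj G A)

module _ {X : Set} {_∼_ : X → X → Set} where

  ≡⇒closure : ∀ {p q} → p ≡ q → EqClosure _∼_ p q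
  ≡⇒closure refl = ε

  closure-sym : ∀ {p q} → EqClosure _∼_ p q → EqClosure _∼_ q p
  closure-sym = Eq.symmetric _∼_

module _ (G : Graph) (A : EdgeSet G) where

  _⊆_ : (V G → Bool) → (V G → Bool) → Set
  S ⊆ S′ = ∀ v → S v ≡ true → S′ v ≡ true

  step⁻ : ∀ S v → step G A S v ≡ true → ∃ λ u → S u ≡ true × Conn G A u v
  step⁻ S v h with ∨⁻ (S v) h
  ... | inj₁ Sv = v , Sv , ε
  ... | inj₂ h′ with anyF⁻ (nE G) _ h′
  ...   | e , h″ with ∧⁻ (lookup A e) h″
  ...     | Ae , ends-e with ∨⁻ (S (proj₁ (ends G e)) ∧ _) ends-e
  ...       | inj₁ f with ∧⁻ (S (proj₁ (ends G e))) f
  ...         | Su , e≡v = _ , Su , fwd (e , Ae , cong (_ ,_) (⌊⌋⁻ e≡v)) ◅ ε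
  step⁻ S v h | inj₂ h′ | e , h″ | Ae , ends-e | inj₂ f with ∧⁻ (S (proj₂ (ends G e))) f
  ...         | Su , e≡v = _ , Su , bwd (e , Ae , cong (_, _) (⌊⌋⁻ e≡v)) ◅ ε

  step-⊇ : ∀ S → S ⊆ step G A S
  step-⊇ S v Sv = ∨⁺ˡ _ Sv

  step-fwd : ∀ S {u v} → Adj G A u v → S u ≡ true → step G A S v ≡ true
  step-fwd S {u} {v} (e , Ae , refl) Su = ∨⁺ʳ (S v) (anyF⁺ (nE G) _ e
    (∧⁺ Ae (∨⁺ˡ _ (∧⁺ Su (⌊⌋⁺ {P? = v ≟ v} refl)))))

  step-bwd : ∀ S {u v} → Adj G A u v → S v ≡ true → step G A S u ≡ true
  step-bwd S {u} {v} (e , Ae , refl) Sv = ∨⁺ʳ (S u) (anyF⁺ (nE G) _ e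
    (∧⁺ Ae (∨⁺ʳ (S u ∧ _) (∧⁺ Sv (⌊⌋⁺ {P? = u ≟ u} refl)))))

  closed-Conn : ∀ S → step G A S ⊆ S → ∀ {u v} → Conn G A u v → S u ≡ true → S v ≡ true
  closed-Conn S closed ε              Su = Su
  closed-Conn S closed (fwd uv ◅ vw) Su = closed-Conn S closed vw (closed _ (step-fwd S uv Su))
  closed-Conn S closed (bwd vu ◅ vw) Su = closed-Conn S closed vw (closed _ (step-bwd S vu Su))

  closed-step : ∀ S → step G A S ⊆ S → step G A (step G A S) ⊆ step G A S
  closed-step S closed v h with step⁻ (step G A S) v h
  ... | w , Sw , w~v = step-⊇ S v (closed-Conn S closed w~v (closed w Sw))

  reachable⇒Conn : ∀ {u v} → reachable G A u v ≡ true → Conn G A u v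
  reachable⇒Conn {u} = go (nV G)
    where
    go : ∀ n {v} → iter n (step G A) (eqF u) v ≡ true → Conn G A u v
    go zero    u≡v = ≡⇒closure (⌊⌋⁻ u≡v)
    go (suc n) h with step⁻ _ _ h
    ... | _ , Sw , w~v = go n Sw ◅◅ w~v

  -- The search set gains a vertex in each step until it is closed, so it is
  -- closed after |V| steps.
  search-closed : ∀ u → let S = iter (nV G) (step G A) (eqF u) in step G A S ⊆ S
  search-closed u with progress (nV G)
    where
    S : ℕ → V G → Bool
    S n = iter n (step G A) (eqF u)

    -- The start set already has one vertex, hence the strict bound; at `n = nV G` it contradicts
    -- `countF≤n`.
    progress : ∀ n → step G A (S n) ⊆ S n ⊎ n < countF (nV G) (S n)
    progress zero = inj₂ (≤-trans (s≤s z≤n)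
      (countF-⊂ (nV G) (λ _ → false) (eqF u) u (λ _ ()) (⌊⌋⁺ {P? = u ≟ u} refl) λ ()))
    progress (suc n) with progress n
    ... | inj₁ closed = inj₁ (closed-step (S n) closed)
    ... | inj₂ n< with any? (λ v → (S (suc n) v Bool.≟ true) ×-dec ¬? (S n v Bool.≟ true))
    ...   | yes (v , new , old) =
            inj₂ (≤-trans (s≤s n<) (countF-⊂ (nV G) (S n) (S (suc n)) v (step-⊇ (S n)) new old))
    ...   | no ¬new = inj₁ (closed-step (S n) closed)
      where
      closed : step G A (S n) ⊆ S n
      closed v new with S n v Bool.≟ true
      ... | yes old = old
      ... | no ¬old = contradiction (v , new , ¬old) ¬new
  ... | inj₁ closed = closed
  ... | inj₂ n<     = contradiction (countF≤n (nV G) _) (<⇒≱ n<)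

  -- The final search set contains `u` and is closed under `step`, so no walk from `u` can leave it.
  Conn⇒reachable : ∀ {u v} → Conn G A u v → reachable G A u v ≡ true
  Conn⇒reachable {u} u~v = closed-Conn _ (search-closed u) u~v (start (nV G))
    where
    start : ∀ n → iter n (step G A) (eqF u) u ≡ true
    start zero    = ⌊⌋⁺ {P? = u ≟ u} refl
    start (suc n) = step-⊇ (iter n (step G A) (eqF u)) u (start n)

  Conn? : ∀ u v → Dec (Conn G A u v)
  Conn? u v = map′ reachable⇒Conn Conn⇒reachable (reachable G A u v Bool.≟ true)

-- Representatives of classes

least : ∀ {n} {P : Pred (Fin n) 0ℓ} → Decidable P → ∃ P →
        ∃ λ i → P i × ∀ j → P j → toℕ i ≤ toℕ j
least {suc n} P? (i , Pi) with P? zero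
least {suc n} P? (i , Pi)     | yes P0 = zero , P0 , λ _ _ → z≤n
least {suc n} P? (zero , Pi)  | no ¬P0 = contradiction Pi ¬P0
least {suc n} P? (suc i , Pi) | no ¬P0 with least (P? ∘ suc) (i , Pi)
... | j , Pj , min = suc j , Pj , λ
  { zero    P0 → contradiction P0 ¬P0
  ; (suc l) Pl → s≤s (min l Pl) }

module _ (G : Graph) (A : EdgeSet G) where

  module _ {n} (z : Fin n → V G) where

    private
      root : ∀ i → ∃ λ j → Conn G A (z j) (z i) × ∀ l → Conn G A (z l) (z i) → toℕ j ≤ toℕ l
      root i = least (λ j → Conn? G A (z j) (z i)) (i , ε)

    -- With `z = id` this picks the root of a component; with `z` a list of terminals it labels the
    -- partition that the components induce on them. Taking the least index makes the labels
    -- canonical and at most the index itself.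
    rep : Fin n → Fin n
    rep i = proj₁ (root i)

    rep-Conn : ∀ i → Conn G A (z (rep i)) (z i)
    rep-Conn i = proj₁ (proj₂ (root i))

    rep-least : ∀ i l → Conn G A (z l) (z i) → toℕ (rep i) ≤ toℕ l
    rep-least i = proj₂ (proj₂ (root i))

    rep-cong : ∀ {i j} → Conn G A (z i) (z j) → rep i ≡ rep j
    rep-cong {i} {j} i~j = toℕ-injective (≤-antisym
      (rep-least i (rep j) (rep-Conn j ◅◅ closure-sym i~j))
      (rep-least j (rep i) (rep-Conn i ◅◅ i~j)))

    rep-reflects : ∀ {i j} → rep i ≡ rep j → Conn G A (z i) (z j)
    rep-reflects {i} {j} e = closure-sym (rep-Conn i) ◅◅ ≡⇒closure (cong z e) ◅◅ rep-Conn j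

  -- The predicate counted in `ncomp`, so that `ncomp G A` is `countF (nV G) (isLeast G A)` by
  -- definition.
  isLeast : V G → Bool
  isLeast v = not (anyF (nV G) (λ u → ⌊ toℕ u <? toℕ v ⌋ ∧ reachable G A u v))

  isLeast⁺ : ∀ v → (∀ u → Conn G A u v → toℕ v ≤ toℕ u) → isLeast v ≡ true
  isLeast⁺ v min with anyF (nV G) (λ u → ⌊ toℕ u <? toℕ v ⌋ ∧ reachable G A u v) in eq
  ... | false = refl
  ... | true with anyF⁻ (nV G) _ eq
  ...   | u , h with ∧⁻ ⌊ toℕ u <? toℕ v ⌋ h
  ...     | u<v , ru = contradiction (min u (reachable⇒Conn G A ru)) (<⇒≱ (⌊⌋⁻ u<v))

  isLeast⁻ : ∀ v → isLeast v ≡ true → ∀ u → Conn G A u v → toℕ v ≤ toℕ u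
  isLeast⁻ v h u u~v = ≮⇒≥ λ u<v → contradiction
    (trans (sym h) (cong not (anyF⁺ (nV G) _ u
      (∧⁺ (⌊⌋⁺ {P? = toℕ u <? toℕ v} u<v) (Conn⇒reachable G A u~v))))) λ ()

-- Each root `v` goes to the root of the component of `f v`; reflection of connectivity makes this
-- injective on roots. Thus `f` is judged on components only, and may merge vertices of the same
-- component.
ncomp-≤ : ∀ G A H B (f : V G → V H) →
          (∀ u v → Conn H B (f u) (f v) → Conn G A u v) → ncomp G A ≤ ncomp H B
ncomp-≤ G A H B f reflects = countF-inj (isLeast G A) (isLeast H B) (rep H B id ∘ f)
  (λ v _ → isLeast⁺ H B _ λ u u~ → rep-least H B id (f v) u (u~ ◅◅ rep-Conn H B id (f v)))
  (λ u v lu lv e → let u~v = reflects u v (rep-reflects H B id e) in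
    toℕ-injective (≤-antisym (isLeast⁻ G A u lu v (closure-sym u~v)) (isLeast⁻ G A v lv u u~v)))

-- Automorphisms

infixr 9 _∘ᵃ_

idᵃ : ∀ {G} → Automorphism G
idᵃ = record
  { σ = id ; σ⁻¹ = id ; σσ⁻¹ = λ _ → refl ; σ⁻¹σ = λ _ → refl
  ; τ = id ; τ⁻¹ = id ; ττ⁻¹ = λ _ → refl ; τ⁻¹τ = λ _ → refl
  ; compat = λ _ → inj₁ refl }

_∘ᵃ_ : ∀ {G} → Automorphism G → Automorphism G → Automorphism G
_∘ᵃ_ {G} α β = record
  { σ    = σ α ∘ σ β
  ; σ⁻¹  = σ⁻¹ β ∘ σ⁻¹ α
  ; σσ⁻¹ = λ v → trans (cong (σ α) (σσ⁻¹ β _)) (σσ⁻¹ α v)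
  ; σ⁻¹σ = λ v → trans (cong (σ⁻¹ β) (σ⁻¹σ α _)) (σ⁻¹σ β v)
  ; τ    = τ α ∘ τ β
  ; τ⁻¹  = τ⁻¹ β ∘ τ⁻¹ α
  ; ττ⁻¹ = λ e → trans (cong (τ α) (ττ⁻¹ β _)) (ττ⁻¹ α e)
  ; τ⁻¹τ = λ e → trans (cong (τ⁻¹ β) (τ⁻¹τ α _)) (τ⁻¹τ β e)
  ; compat = compat-∘
  }
  where
  compat-∘ : ∀ e → ends G (τ α (τ β e)) ≡ Product.map (σ α ∘ σ β) (σ α ∘ σ β) (ends G e)
                 ⊎ ends G (τ α (τ β e)) ≡ swap (Product.map (σ α ∘ σ β) (σ α ∘ σ β) (ends G e))
  compat-∘ e with compat α (τ β e) | compat β e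
  ... | inj₁ p | inj₁ q = inj₁ (trans p (cong (Product.map (σ α) (σ α)) q))
  ... | inj₁ p | inj₂ q = inj₂ (trans p (cong (Product.map (σ α) (σ α)) q))
  ... | inj₂ p | inj₁ q = inj₂ (trans p (cong (swap ∘ Product.map (σ α) (σ α)) q))
  ... | inj₂ p | inj₂ q = inj₁ (trans p (cong (swap ∘ Product.map (σ α) (σ α)) q))

invᵃ : ∀ {G} → Automorphism G → Automorphism G
invᵃ {G} α = record
  { σ = σ⁻¹ α ; σ⁻¹ = σ α ; σσ⁻¹ = σ⁻¹σ α ; σ⁻¹σ = σσ⁻¹ α
  ; τ = τ⁻¹ α ; τ⁻¹ = τ α ; ττ⁻¹ = τ⁻¹τ α ; τ⁻¹τ = ττ⁻¹ α
  ; compat = compat⁻¹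
  }
  where
  unmap : ∀ p → p ≡ Product.map (σ⁻¹ α) (σ⁻¹ α) (Product.map (σ α) (σ α) p)
  unmap (u , v) = cong₂ _,_ (sym (σ⁻¹σ α u)) (sym (σ⁻¹σ α v))

  compat⁻¹ : ∀ e → ends G (τ⁻¹ α e) ≡ Product.map (σ⁻¹ α) (σ⁻¹ α) (ends G e)
                 ⊎ ends G (τ⁻¹ α e) ≡ swap (Product.map (σ⁻¹ α) (σ⁻¹ α) (ends G e))
  compat⁻¹ e with compat α (τ⁻¹ α e)
  ... | inj₁ p = inj₁ (trans (unmap _)
    (cong (Product.map (σ⁻¹ α) (σ⁻¹ α)) (trans (sym p) (cong (ends G) (ττ⁻¹ α e)))))
  ... | inj₂ p = inj₂ (trans (unmap _)
    (cong (Product.map (σ⁻¹ α) (σ⁻¹ α) ∘ swap) (trans (sym p) (cong (ends G) (ττ⁻¹ α e)))))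

powᵃ : ∀ {G} → Automorphism G → ℕ → Automorphism G
powᵃ α zero    = idᵃ
powᵃ α (suc n) = α ∘ᵃ powᵃ α n

σ-injective : ∀ {G} (α : Automorphism G) → Injective _≡_ _≡_ (σ α)
σ-injective α {u} {v} e = trans (sym (σ⁻¹σ α u)) (trans (cong (σ⁻¹ α) e) (σ⁻¹σ α v))

-- Cyclic indices

module _ {k : ℕ} where

  private n = suc k

  %-absorbˡ : ∀ a b → (a % n + b) % n ≡ (a + b) % n
  %-absorbˡ a b = begin
    (a % n + b) % n         ≡⟨ %-distribˡ-+ (a % n) b n ⟩
    (a % n % n + b % n) % n ≡⟨ cong (λ c → (c + b % n) % n) (m%n%n≡m%n a n) ⟩
    (a % n + b % n) % n     ≡⟨ %-distribˡ-+ a b n ⟨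
    (a + b) % n             ∎
    where open ≡-Reasoning

  %-absorbʳ : ∀ a b → (a + b % n) % n ≡ (a + b) % n
  %-absorbʳ a b = begin
    (a + b % n) % n ≡⟨ cong (_% n) (+-comm a (b % n)) ⟩
    (b % n + a) % n ≡⟨ %-absorbˡ b a ⟩
    (b + a) % n     ≡⟨ cong (_% n) (+-comm b a) ⟩
    (a + b) % n     ∎
    where open ≡-Reasoning

  -- Adding the complement `z′` to both sides completes `z` to a full period `n`.
  %-cancelʳ : ∀ a b {z z′} → z + z′ ≡ n → (a + z) % n ≡ (b + z) % n → a % n ≡ b % n
  %-cancelʳ a b {z} {z′} z+z′≡n e = trans (unfold a) (trans (cong (λ c → (c + z′) % n) e) (sym (unfold b)))
    where
    open ≡-Reasoning
    unfold : ∀ a → a % n ≡ ((a + z) % n + z′) % n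
    unfold a = begin
      a % n                  ≡⟨ [m+n]%n≡m%n a n ⟨
      (a + n) % n            ≡⟨ cong (λ c → (a + c) % n) z+z′≡n ⟨
      (a + (z + z′)) % n     ≡⟨ cong (_% n) (+-assoc a z z′) ⟨
      (a + z + z′) % n       ≡⟨ %-absorbˡ (a + z) z′ ⟨
      ((a + z) % n + z′) % n ∎

  toℕ-+ₘ : ∀ (i : Fin n) s → toℕ (i +ₘ s) ≡ (toℕ i + s) % n
  toℕ-+ₘ i s = toℕ-fromℕ< (m%n<n (toℕ i + s) n)

  +ₘ-identityʳ : ∀ (i : Fin n) → i +ₘ 0 ≡ i
  +ₘ-identityʳ i = toℕ-injective (trans (toℕ-+ₘ i 0)
    (trans (cong (_% n) (+-identityʳ (toℕ i))) (m<n⇒m%n≡m (toℕ<n i))))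

  +ₘ-assoc : ∀ (i : Fin n) s t → (i +ₘ s) +ₘ t ≡ i +ₘ (s + t)
  +ₘ-assoc i s t = toℕ-injective (begin
    toℕ ((i +ₘ s) +ₘ t)       ≡⟨ toℕ-+ₘ (i +ₘ s) t ⟩
    (toℕ (i +ₘ s) + t) % n    ≡⟨ cong (λ c → (c + t) % n) (toℕ-+ₘ i s) ⟩
    ((toℕ i + s) % n + t) % n ≡⟨ %-absorbˡ (toℕ i + s) t ⟩
    (toℕ i + s + t) % n       ≡⟨ cong (_% n) (+-assoc (toℕ i) s t) ⟩
    (toℕ i + (s + t)) % n     ≡⟨ toℕ-+ₘ i (s + t) ⟨
    toℕ (i +ₘ (s + t))        ∎)
    where open ≡-Reasoning

  -- With n = k + 1: i + m ≡ −1 − (c − i + s) (mod n) for m ≡ −1 − c − s.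
  turn : Fin n → ℕ → ℕ
  turn c s = (k ∸ toℕ c) + s * k

  -- A reflection of the indices followed by reversal of their order is a rotation, so a power of
  -- `ψ` can realise it on the `u i`. The proof adds `suc (toℕ j)` to both sides, which makes each
  -- of them a multiple of `n`.
  turn-opposite : ∀ c s i → i +ₘ turn c s ≡ opposite (reflectₘ c i +ₘ s)
  turn-opposite c s i = toℕ-injective (begin
    toℕ (i +ₘ m)           ≡⟨ toℕ-+ₘ i m ⟩
    (toℕ i + m) % n        ≡⟨ %-cancelʳ (toℕ i + m) (toℕ (opposite j)) complement cancelled ⟩
    toℕ (opposite j) % n   ≡⟨ m<n⇒m%n≡m (toℕ<n (opposite j)) ⟩
    toℕ (opposite j)       ∎)
    where
    open ≡-Reasoning
    m = turn c s
    j = reflectₘ c i +ₘ s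
    p = n ∸ toℕ i
    q = k ∸ toℕ c

    complement : suc (toℕ j) + toℕ (opposite j) ≡ n
    complement = trans (cong (suc (toℕ j) +_) (opposite-prop j)) (m+[n∸m]≡n (toℕ<n j))

    toℕ-j : toℕ j ≡ (toℕ c + p + s) % n
    toℕ-j = trans (toℕ-+ₘ (reflectₘ c i) s)
      (trans (cong (λ a → (a + s) % n) (toℕ-fromℕ< (m%n<n (toℕ c + p) n)))
             (%-absorbˡ (toℕ c + p) s))

    regroup : ∀ i q c p s k → (i + (q + s * k) + 1) + (c + p + s) ≡ (i + p) + suc (q + c) + s * suc k
    regroup = solve-∀

    cancelled : (toℕ i + m + suc (toℕ j)) % n ≡ (toℕ (opposite j) + suc (toℕ j)) % n
    cancelled = begin
      (toℕ i + m + suc (toℕ j)) % n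
        ≡⟨ cong (_% n) (+-assoc (toℕ i + m) 1 (toℕ j)) ⟨
      (toℕ i + m + 1 + toℕ j) % n
        ≡⟨ cong (λ a → (toℕ i + m + 1 + a) % n) toℕ-j ⟩
      (toℕ i + m + 1 + (toℕ c + p + s) % n) % n
        ≡⟨ %-absorbʳ (toℕ i + m + 1) (toℕ c + p + s) ⟩
      (toℕ i + m + 1 + (toℕ c + p + s)) % n
        ≡⟨ cong (_% n) (regroup (toℕ i) q (toℕ c) p s k) ⟩
      ((toℕ i + p) + suc (q + toℕ c) + s * n) % n
        ≡⟨ [m+kn]%n≡m%n ((toℕ i + p) + suc (q + toℕ c)) s n ⟩
      ((toℕ i + p) + suc (q + toℕ c)) % n
        ≡⟨ cong₂ (λ a b → (a + suc b) % n) (m+[n∸m]≡n (≤-trans (toℕ≤pred[n] i) (n≤1+n k))) (m∸n+n≡m (toℕ≤pred[n] c)) ⟩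
      (n + n) % n
        ≡⟨ [m+n]%n≡m%n n n ⟩
      n % n
        ≡⟨ cong (_% n) (trans (+-comm (toℕ (opposite j)) _) complement) ⟨
      (toℕ (opposite j) + suc (toℕ j)) % n ∎

  pow-shift : ∀ {G} (α : Automorphism G) (z : Fin n → V G) s →
              (∀ i → σ α (z i) ≡ z (i +ₘ s)) →
              ∀ t i → σ (powᵃ α t) (z i) ≡ z (i +ₘ (t * s))
  pow-shift α z s shift zero    i = cong z (sym (+ₘ-identityʳ i))
  pow-shift α z s shift (suc t) i = begin
    σ α (σ (powᵃ α t) (z i))   ≡⟨ cong (σ α) (pow-shift α z s shift t i) ⟩
    σ α (z (i +ₘ (t * s)))     ≡⟨ shift _ ⟩
    z ((i +ₘ (t * s)) +ₘ s)    ≡⟨ cong z (+ₘ-assoc i (t * s) s) ⟩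
    z (i +ₘ (t * s + s))       ≡⟨ cong (λ a → z (i +ₘ a)) (+-comm (t * s) s) ⟩
    z (i +ₘ (s + t * s))       ∎
    where open ≡-Reasoning

-- Reflections fixing a partition of at most five points

-- A partition is coded by sending each point to the least point of its block,
-- so label i is at most i; this keeps the enumeration small.
Bounded : ∀ {n m} → ℕ → Vec (Fin n) m → Set
Bounded o []      = ⊤
Bounded o (i ∷ c) = toℕ i ≤ o × Bounded (suc o) c

-- The bound on an entry is tested before the remaining entries are enumerated, so a bad entry cuts
-- off its whole branch; for r points r! codes remain.
allBounded? : ∀ {n m} {P : Pred (Vec (Fin n) m) 0ℓ} o → Decidable P →
              Dec (∀ c → Bounded o c → P c)
allBounded? {m = zero}  o P? = map′ (λ { p [] _ → p }) (λ p → p [] tt) (P? [])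
allBounded? {m = suc m} o P? =
  map′ (λ { p (i ∷ c) (i≤o , b) → p i i≤o c b }) (λ p i i≤o c b → p (i ∷ c) (i≤o , b))
       (all? λ i → (toℕ i ≤? o) →-dec allBounded? (suc o) λ c → P? (i ∷ c))

tabulate-bounded : ∀ {n m} o (f : Fin m → Fin n) → (∀ i → toℕ (f i) ≤ o + toℕ i) →
                   Bounded o (tabulate f)
tabulate-bounded {m = zero}  o f f≤ = tt
tabulate-bounded {m = suc m} o f f≤ =
  subst (toℕ (f zero) ≤_) (+-identityʳ o) (f≤ zero) ,
  tabulate-bounded (suc o) (f ∘ suc) λ i → subst (toℕ (f (suc i)) ≤_) (+-suc o (toℕ i)) (f≤ (suc i))

-- Only equality of labels is compared, so `π` may permute the blocks.
Preserves : ∀ {r} → (Fin r → Fin r) → Vec (Fin r) r → Set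
Preserves π c = ∀ i j → eqF (lookup c i) (lookup c j) ≡ eqF (lookup c (π i)) (lookup c (π j))

-- For fixed `d`, the shift `t` runs through all r reflections of the cyclic indices. With `d` the
-- constant of `ρ` on the `x i`, these are the permutations induced by `φᵗρ`.
ReflectionSymmetric : ℕ → Set
ReflectionSymmetric r = (d : Fin r) (c : Vec (Fin r) r) → Bounded 0 c →
  ∃ λ (t : Fin r) → Preserves (λ i → reflectₘ d i +ₘ toℕ t) c

reflectionSymmetric? : ∀ r → Dec (ReflectionSymmetric r)
reflectionSymmetric? r =
  all? λ d → allBounded? 0 λ c → any? λ t → all? λ i → all? λ j → _ Bool.≟ _

-- Every partition of the vertices of an r-gon is fixed by one of its
-- reflections when r ≤ 5; {1},{2,4},{3,5,6} shows that r = 6 fails.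
reflectionSymmetric : ∀ r → r ≤ 5 → ReflectionSymmetric r
reflectionSymmetric 0 _ ()
reflectionSymmetric 1 _ = toWitness {a? = reflectionSymmetric? 1} tt
reflectionSymmetric 2 _ = toWitness {a? = reflectionSymmetric? 2} tt
reflectionSymmetric 3 _ = toWitness {a? = reflectionSymmetric? 3} tt
reflectionSymmetric 4 _ = toWitness {a? = reflectionSymmetric? 4} tt
reflectionSymmetric 5 _ = toWitness {a? = reflectionSymmetric? 5} tt
reflectionSymmetric (suc (suc (suc (suc (suc (suc _)))))) (s≤s (s≤s (s≤s (s≤s (s≤s ())))))

eqF⇔ : ∀ {n m} {a b : Fin n} {c d : Fin m} → eqF a b ≡ eqF c d → (a ≡ b → c ≡ d) × (c ≡ d → a ≡ b)
eqF⇔ {a = a} {b} {c} {d} e =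
  (λ a≡b → ⌊⌋⁻ (trans (sym e) (⌊⌋⁺ {P? = a ≟ b} a≡b))) ,
  (λ c≡d → ⌊⌋⁻ (trans e (⌊⌋⁺ {P? = c ≟ d} c≡d)))

module _ (G : Graph) (A : EdgeSet G) {r} (z : Fin r → V G) where

  Invariant : (Fin r → Fin r) → Set
  Invariant π = ∀ i j → (Conn G A (z i) (z j) → Conn G A (z (π i)) (z (π j))) ×
                        (Conn G A (z (π i)) (z (π j)) → Conn G A (z i) (z j))

  -- Labelling the terminals by `rep` encodes their partition as a bounded vector, to which the
  -- finite check applies; the bound holds because each terminal lies in its own class.
  invariant-reflection : r ≤ 5 → (d : Fin r) → ∃ λ (t : Fin r) → Invariant (λ i → reflectₘ d i +ₘ toℕ t)
  invariant-reflection r≤5 d =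
    let labels = tabulate (rep G A z)
        t , preserves = reflectionSymmetric r r≤5 d labels
          (tabulate-bounded 0 (rep G A z) λ i → rep-least G A z i i ε)
        π = λ i → reflectₘ d i +ₘ toℕ t
        label : ∀ i → lookup labels i ≡ rep G A z i
        label = lookup∘tabulate (rep G A z)
        preserves′ : ∀ i j → _
        preserves′ i j = eqF⇔ (subst₂ _≡_ (cong₂ eqF (label i) (label j))
                                          (cong₂ eqF (label (π i)) (label (π j))) (preserves i j))
    in t , λ i j →
      (λ c → rep-reflects G A z (proj₁ (preserves′ i j) (rep-cong G A z c))) ,
      (λ c → rep-reflects G A z (proj₂ (preserves′ i j) (rep-cong G A z c)))

  -- The map induced by π on the components meeting the terminals, lifted to
  -- vertices; it fixes every other vertex.
  shift : (Fin r → Fin r) → V G → V G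
  shift π v with any? (λ i → Conn? G A v (z i))
  ... | yes (i , _) = z (π i)
  ... | no _        = v

  module _ {π : Fin r → Fin r} (inv : Invariant π) where

    shift-terminal : ∀ {v} i → Conn G A v (z i) → Conn G A (shift π v) (z (π i))
    shift-terminal {v} i v~i with any? (λ i → Conn? G A v (z i))
    ... | yes (j , v~j) = proj₁ (inv j i) (closure-sym v~j ◅◅ v~i)
    ... | no ¬v~        = contradiction (i , v~i) ¬v~

    shift-Conn : ∀ {u v} → Conn G A u v → Conn G A (shift π u) (shift π v)
    shift-Conn {u} {v} u~v with any? (λ i → Conn? G A u (z i))
    ... | yes (i , u~i) = closure-sym (shift-terminal i (closure-sym u~v ◅◅ u~i))
    ... | no ¬u~ with any? (λ i → Conn? G A v (z i))
    ...   | yes (i , v~i) = contradiction (i , (u~v ◅◅ v~i)) ¬u~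
    ...   | no _          = u~v

    -- The composite returns only to the component of `v`, since `shift` sends a whole component to
    -- one terminal.
    shift-cancel : ∀ {π⁻¹} → (∀ i → π (π⁻¹ i) ≡ i) → ∀ v → Conn G A (shift π (shift π⁻¹ v)) v
    shift-cancel ππ⁻¹ v with any? (λ i → Conn? G A v (z i)) in eq
    ... | yes (i , v~i) = shift-terminal _ ε ◅◅ ≡⇒closure (cong z (ππ⁻¹ i)) ◅◅ closure-sym v~i
    -- The inner `shift` leaves `v` alone, so the outer one repeats the same test with the same
    -- outcome.
    ... | no ¬v~ rewrite eq = ε

-- Gluing

open IsGluing

-- Every vertex of `H` has a representative in `W` or a non-terminal one in `G`, and the same
-- representative names a vertex of `H′`. This serves to match `nV` in the exponent of y-1.
nV-≤ : ∀ {G W H H′ k} {a a′ : Fin k → V G} {b : Fin k → V W} →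
       IsGluing G k a W b H → IsGluing G k a′ W b H′ → (∀ i → ∃ λ j → a′ i ≡ a j) → nV H ≤ nV H′
nV-≤ {G} {W} {H} {H′} gH gH′ a′⊆a = injective⇒≤ {f = f} f-inj
  where
  -- Prefer a representative in W, so that the terminals of G need no matching.
  locate : ∀ h → (∃ λ v → ιW gH v ≡ h) ⊎ (∃ λ v → ιG gH v ≡ h × (∀ i → v ≢ _))
  locate h with any? (λ v → ιW gH v ≟ h) | cover gH h
  ... | yes inW | _                = inj₁ inW
  ... | no ¬inW | inj₂ inW         = contradiction inW ¬inW
  ... | no ¬inW | inj₁ (v , ιv≡h) =
    inj₂ (v , ιv≡h , λ i v≡ai → ¬inW (_ , trans (sym (glue gH i)) (trans (cong (ιG gH) (sym v≡ai)) ιv≡h)))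

  f : V H → V H′
  f h = [ ιW gH′ ∘ proj₁ , ιG gH′ ∘ proj₁ ]′ (locate h)

  f-inj : Injective _≡_ _≡_ f
  f-inj {h} {h′} e with locate h | locate h′
  ... | inj₁ (v , p) | inj₁ (v′ , p′) = trans (sym p) (trans (cong (ιW gH) (ιW-inj gH′ e)) p′)
  -- A coincidence in `H′` would make `v′` a terminal of `a′`, hence one of `a`, against the choice
  -- of `v′`.
  ... | inj₁ (v , p) | inj₂ (v′ , p′ , ¬a) with only gH′ v′ v (sym e)
  ...   | i , v′≡ , _ = contradiction (trans v′≡ (proj₂ (a′⊆a i))) (¬a (proj₁ (a′⊆a i)))
  f-inj e | inj₂ (v , p , ¬a) | inj₁ (v′ , p′) with only gH′ v v′ e
  ...   | i , v≡ , _ = contradiction (trans v≡ (proj₂ (a′⊆a i))) (¬a (proj₁ (a′⊆a i)))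
  f-inj e | inj₂ (v , p , _) | inj₂ (v′ , p′ , _) =
    trans (sym p) (trans (cong (ιG gH) (ιG-inj gH′ e)) p′)

-- Transport of edge sets along bijections

pull : ∀ {m n} → (Fin n → Fin m) → Vec Bool m → Vec Bool n
pull f A = tabulate (lookup A ∘ f)

pull-pull : ∀ {m n} (f : Fin n → Fin m) (g : Fin m → Fin n) → (∀ i → f (g i) ≡ i) →
            ∀ A → pull g (pull f A) ≡ A
pull-pull f g fg A = trans
  (tabulate-cong (λ i → trans (lookup∘tabulate _ (g i)) (cong (lookup A) (fg i))))
  (tabulate∘lookup A)

pull-replicate : ∀ {m n} (f : Fin n → Fin m) b → pull f (replicate m b) ≡ replicate n b
pull-replicate f b = trans
  (tabulate-cong (λ i → trans (lookup-replicate (f i) b) (sym (lookup-replicate i b))))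
  (tabulate∘lookup _)

countF-pull : ∀ {m n} (f : Fin n → Fin m) (g : Fin m → Fin n) →
              (∀ i → f (g i) ≡ i) → (∀ i → g (f i) ≡ i) →
              ∀ A → countF m (lookup A) ≡ countF n (lookup (pull f A))
countF-pull f g fg gf A = ≤-antisym
  (countF-inj (lookup A) (lookup (pull f A)) g
    (λ i Ai → trans (lookup∘tabulate _ (g i)) (trans (cong (lookup A) (fg i)) Ai))
    (λ i j _ _ e → trans (sym (fg i)) (trans (cong f e) (fg j))))
  (countF-inj (lookup (pull f A)) (lookup A) f
    (λ i fAi → trans (sym (lookup∘tabulate _ i)) fAi)
    (λ i j _ _ e → trans (sym (gf i)) (trans (cong g e) (gf j))))

-- Connectivity of the glued graph in terms of its three pieces

module Pieces (R W₀ Y : Graph) {k r : ℕ}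
              (w : Fin k → V W₀) (x : Fin r → V W₀) (y : Fin r → V Y) where

  Vertex Edge : Set
  Vertex = V R ⊎ V W₀ ⊎ V Y
  Edge   = E R ⊎ E W₀ ⊎ E Y

  -- The glued graph is modelled on the disjoint union of the three vertex sets, with
  -- identifications as additional links. Maps can then be defined piece by piece without checking
  -- that they respect a quotient.
  data Link (a : Fin k → V R) (B : Edge → Bool) : Vertex → Vertex → Set where
    edgeR  : ∀ e {p q} → B (inj₁ e) ≡ true → ends R e ≡ (p , q) → Link a B (inj₁ p) (inj₁ q)
    edgeW  : ∀ e {p q} → B (inj₂ (inj₁ e)) ≡ true → ends W₀ e ≡ (p , q) →
             Link a B (inj₂ (inj₁ p)) (inj₂ (inj₁ q))
    edgeY  : ∀ e {p q} → B (inj₂ (inj₂ e)) ≡ true → ends Y e ≡ (p , q) →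
             Link a B (inj₂ (inj₂ p)) (inj₂ (inj₂ q))
    glueRW : ∀ i → Link a B (inj₁ (a i)) (inj₂ (inj₁ (w i)))
    glueWY : ∀ i → Link a B (inj₂ (inj₁ (x i))) (inj₂ (inj₂ (y i)))

  Joined : (Fin k → V R) → (Edge → Bool) → Vertex → Vertex → Set
  Joined a B = EqClosure (Link a B)

  -- On `Y` the vertices move by `δ` while `moveE` fixes the edges, so the map respects components
  -- there rather than incidence.
  move : Automorphism R → Automorphism W₀ → (V Y → V Y) → Vertex → Vertex
  move α β δ = Sum.map (σ α) (Sum.map (σ β) δ)

  moveE : Automorphism R → Automorphism W₀ → Edge → Edge
  moveE α β = Sum.map (τ α) (Sum.map (τ β) id)

  moveE-inv : ∀ α β e → moveE α β (moveE (invᵃ α) (invᵃ β) e) ≡ e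
  moveE-inv α β (inj₁ e)        = cong inj₁ (ττ⁻¹ α e)
  moveE-inv α β (inj₂ (inj₁ e)) = cong (inj₂ ∘ inj₁) (ττ⁻¹ β e)
  moveE-inv α β (inj₂ (inj₂ e)) = refl

  module _ {a : Fin k → V R} {B : Edge → Bool} (A : EdgeSet Y)
           (B≡A : ∀ e → B (inj₂ (inj₂ e)) ≡ lookup A e) where

    Conn⇒Joined : ∀ {u v} → Conn Y A u v → Joined a B (inj₂ (inj₂ u)) (inj₂ (inj₂ v))
    Conn⇒Joined = Eq.gmap (inj₂ ∘ inj₂) λ { (e , Ae , ends-e) → edgeY e (trans (B≡A e) Ae) ends-e }

  module _ {a₁ a₂ : Fin k → V R} {B₁ B₂ : Edge → Bool} (A : EdgeSet Y)
           (α : Automorphism R) (β : Automorphism W₀) (δ : V Y → V Y)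
           (B₂≡B₁ : ∀ e → B₂ (moveE α β e) ≡ B₁ e)
           (B₂≡A : ∀ e → B₂ (inj₂ (inj₂ e)) ≡ lookup A e)
           (onRW : ∀ i → ∃ λ j → σ α (a₁ i) ≡ a₂ j × σ β (w i) ≡ w j)
           (onWY : ∀ i → ∃ λ j → σ β (x i) ≡ x j × Conn Y A (δ (y i)) (y j))
           (δ-Conn : ∀ {u v} → Conn Y A u v → Conn Y A (δ u) (δ v)) where

    -- Edges of `R` and `W₀` go to edges, possibly reversed. An edge of `Y` goes to a walk inside
    -- `Y`, and a link from `x i` to `y i` becomes a link followed by such a walk.
    move-Link : ∀ {p q} → Link a₁ B₁ p q → Joined a₂ B₂ (move α β δ p) (move α β δ q)
    move-Link (edgeR e Be refl) with compat α e
    ... | inj₁ p = fwd (edgeR (τ α e) (trans (B₂≡B₁ (inj₁ e)) Be) p) ◅ ε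
    ... | inj₂ p = bwd (edgeR (τ α e) (trans (B₂≡B₁ (inj₁ e)) Be) p) ◅ ε
    move-Link (edgeW e Be refl) with compat β e
    ... | inj₁ p = fwd (edgeW (τ β e) (trans (B₂≡B₁ (inj₂ (inj₁ e))) Be) p) ◅ ε
    ... | inj₂ p = bwd (edgeW (τ β e) (trans (B₂≡B₁ (inj₂ (inj₁ e))) Be) p) ◅ ε
    move-Link (edgeY e Be ends-e) = Conn⇒Joined A B₂≡A (δ-Conn
      (fwd (e , trans (sym (B₂≡A e)) (trans (B₂≡B₁ (inj₂ (inj₂ e))) Be) , ends-e) ◅ ε))
    move-Link (glueRW i) with onRW i
    ... | j , p , q rewrite p | q = fwd (glueRW j) ◅ ε
    move-Link (glueWY i) with onWY i
    ... | j , p , δy~yj rewrite p = fwd (glueWY j) ◅ Conn⇒Joined A B₂≡A (closure-sym δy~yj)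

    move-Joined : ∀ {p q} → Joined a₁ B₁ p q → Joined a₂ B₂ (move α β δ p) (move α β δ q)
    move-Joined = Eq.gfold (Eq.isEquivalence _) (move α β δ) move-Link

  module _ {a : Fin k → V R} {B : Edge → Bool} (A : EdgeSet Y)
           (B≡A : ∀ e → B (inj₂ (inj₂ e)) ≡ lookup A e)
           (α : Automorphism R) (β : Automorphism W₀) {δ δ⁻¹ : V Y → V Y}
           (δδ⁻¹ : ∀ v → Conn Y A (δ (δ⁻¹ v)) v) where

    move-inv : ∀ p → Joined a B (move α β δ (move (invᵃ α) (invᵃ β) δ⁻¹ p)) p
    move-inv (inj₁ v)        = ≡⇒closure (cong inj₁ (σσ⁻¹ α v))
    move-inv (inj₂ (inj₁ v)) = ≡⇒closure (cong (inj₂ ∘ inj₁) (σσ⁻¹ β v))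
    move-inv (inj₂ (inj₂ v)) = Conn⇒Joined A B≡A (δδ⁻¹ v)

  module Glued {W : Graph} (gW : IsGluing W₀ r x Y y W) (w≢x : ∀ i j → w i ≡ x j → ⊥)
               (a : Fin k → V R) {H : Graph} (gH : IsGluing R k a W (ιG gW ∘ w) H) where

    ι : Vertex → V H
    ι = [ ιG gH , [ ιW gH ∘ ιG gW , ιW gH ∘ ιW gW ] ]

    locate : ∀ h → ∃ λ p → ι p ≡ h
    locate h with cover gH h
    ... | inj₁ (v , p) = inj₁ v , p
    ... | inj₂ (v , p) with cover gW v
    ...   | inj₁ (v′ , p′) = inj₂ (inj₁ v′) , trans (cong (ιW gH) p′) p
    ...   | inj₂ (v′ , p′) = inj₂ (inj₂ v′) , trans (cong (ιW gH) p′) p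

    sec : V H → Vertex
    sec = proj₁ ∘ locate

    ι-sec : ∀ h → ι (sec h) ≡ h
    ι-sec = proj₂ ∘ locate

    edge : Edge → E H
    edge = [ εG gH , εW gH ∘ [ εG gW , εW gW ] ]

    edge⁻¹ : E H → Edge
    edge⁻¹ = Sum.map id (εinv gW) ∘ εinv gH

    edge⁻¹-edge : ∀ e → edge⁻¹ (edge e) ≡ e
    edge⁻¹-edge (inj₁ e)        = cong (Sum.map id (εinv gW)) (εinv-G gH e)
    edge⁻¹-edge (inj₂ (inj₁ e)) = trans (cong (Sum.map id (εinv gW)) (εinv-W gH _)) (cong inj₂ (εinv-G gW e))
    edge⁻¹-edge (inj₂ (inj₂ e)) = trans (cong (Sum.map id (εinv gW)) (εinv-W gH _)) (cong inj₂ (εinv-W gW e))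

    edge-edge⁻¹ : ∀ e → edge (edge⁻¹ e) ≡ e
    edge-edge⁻¹ e with εinv gH e | ε-surj gH e
    ... | inj₁ _  | p = p
    ... | inj₂ e′ | p = trans (cong (εW gH) (ε-surj gW e′)) p

    -- Vertices are identified in `H` only through the glue links, which are present for every `B`.
    ι-kernel : ∀ {B} p q → ι p ≡ ι q → Joined a B p q
    ι-kernel (inj₁ u) (inj₁ v) e = ≡⇒closure (cong inj₁ (ιG-inj gH e))
    ι-kernel (inj₁ u) (inj₂ (inj₁ v)) e with only gH u (ιG gW v) e
    ... | i , refl , v≡ with ιG-inj gW v≡
    ...   | refl = fwd (glueRW i) ◅ ε
    -- A vertex common to `R` and `Y` would come from some `w i` equal to some `x j`.
    ι-kernel (inj₁ u) (inj₂ (inj₂ v)) e with only gH u (ιW gW v) e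
    ... | i , _ , v≡ with only gW (w i) v (sym v≡)
    ...   | j , wi≡xj , _ = ⊥-elim (w≢x i j wi≡xj)
    ι-kernel (inj₂ (inj₁ u)) (inj₂ (inj₁ v)) e = ≡⇒closure (cong (inj₂ ∘ inj₁) (ιG-inj gW (ιW-inj gH e)))
    ι-kernel (inj₂ (inj₁ u)) (inj₂ (inj₂ v)) e with only gW u v (ιW-inj gH e)
    ... | i , refl , refl = fwd (glueWY i) ◅ ε
    ι-kernel (inj₂ (inj₂ u)) (inj₂ (inj₂ v)) e = ≡⇒closure (cong (inj₂ ∘ inj₂) (ιW-inj gW (ιW-inj gH e)))
    ι-kernel p@(inj₂ (inj₁ _)) q@(inj₁ _)        e = closure-sym (ι-kernel q p (sym e))
    ι-kernel p@(inj₂ (inj₂ _)) q@(inj₁ _)        e = closure-sym (ι-kernel q p (sym e))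
    ι-kernel p@(inj₂ (inj₂ _)) q@(inj₂ (inj₁ _)) e = closure-sym (ι-kernel q p (sym e))

    module _ (A : EdgeSet H) where

      private B = lookup A ∘ edge

      Joined⇒Conn : ∀ {p q} → Joined a B p q → Conn H A (ι p) (ι q)
      Joined⇒Conn = Eq.gfold (Eq.isEquivalence _) ι λ
        { (edgeR e Be refl) → fwd (_ , Be , endsG gH e) ◅ ε
        ; (edgeW e Be refl) → fwd (_ , Be , trans (endsW gH _) (cong (Product.map (ιW gH) (ιW gH)) (endsG gW e))) ◅ ε
        ; (edgeY e Be refl) → fwd (_ , Be , trans (endsW gH _) (cong (Product.map (ιW gH) (ιW gH)) (endsW gW e))) ◅ ε
        ; (glueRW i) → ≡⇒closure (glue gH i)
        ; (glueWY i) → ≡⇒closure (cong (ιW gH) (glue gW i)) }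

      edge-Link : ∀ e {h h′} → B e ≡ true → ends H (edge e) ≡ (h , h′) →
                  ∃ λ p → ∃ λ q → Link a B p q × ι p ≡ h × ι q ≡ h′
      edge-Link (inj₁ e) Be refl rewrite endsG gH e = _ , _ , edgeR e Be refl , refl , refl
      edge-Link (inj₂ (inj₁ e)) Be refl rewrite endsW gH (εG gW e) | endsG gW e =
        _ , _ , edgeW e Be refl , refl , refl
      edge-Link (inj₂ (inj₂ e)) Be refl rewrite endsW gH (εW gW e) | endsW gW e =
        _ , _ , edgeY e Be refl , refl , refl

      Adj⇒Joined : ∀ {h h′} → Adj H A h h′ → Joined a B (sec h) (sec h′)
      Adj⇒Joined (e , Ae , ends-e)
        with edge-Link (edge⁻¹ e) (trans (cong (lookup A) (edge-edge⁻¹ e)) Ae)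
                                  (trans (cong (ends H) (edge-edge⁻¹ e)) ends-e)
      ... | p , q , link , refl , refl =
        ι-kernel _ p (ι-sec (ι p)) ◅◅ fwd link ◅ ι-kernel q _ (sym (ι-sec (ι q)))

      -- A walk in `H` is lifted edge by edge through the section `sec`; `ι-kernel` bridges the
      -- different representatives of one vertex.
      Conn⇒Joined-ι : ∀ p q → Conn H A (ι p) (ι q) → Joined a B p q
      Conn⇒Joined-ι p q c =
        ι-kernel p _ (sym (ι-sec (ι p))) ◅◅
        Eq.gfold (Eq.isEquivalence _) sec Adj⇒Joined c ◅◅
        ι-kernel _ q (ι-sec (ι q))

    restrictY : EdgeSet H → EdgeSet Y
    restrictY = pull (edge ∘ inj₂ ∘ inj₂)

  -- The twist of edge sets for one fixed pair of automorphisms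

  module Twist {W : Graph} (gW : IsGluing W₀ r x Y y W) (w≢x : ∀ i j → w i ≡ x j → ⊥)
               (w-inj : Injective _≡_ _≡_ w) (x-inj : Injective _≡_ _≡_ x)
               {a₁ a₂ : Fin k → V R} {H₁ H₂ : Graph}
               (g₁ : IsGluing R k a₁ W (ιG gW ∘ w) H₁)
               (g₂ : IsGluing R k a₂ W (ιG gW ∘ w) H₂)
               (α : Automorphism R) (β : Automorphism W₀) (θ : Fin k → Fin k) (π : Fin r → Fin r)
               (α-a : ∀ i → σ α (a₁ i) ≡ a₂ (θ i))
               (β-w : ∀ i → σ β (w i) ≡ w (θ i))
               (β-x : ∀ i → σ β (x i) ≡ x (π i)) where

    private
      module G₁ = Glued gW w≢x a₁ g₁
      module G₂ = Glued gW w≢x a₂ g₂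

    onEdge : E H₁ → E H₂
    onEdge = G₂.edge ∘ moveE α β ∘ G₁.edge⁻¹

    onEdge⁻¹ : E H₂ → E H₁
    onEdge⁻¹ = G₁.edge ∘ moveE (invᵃ α) (invᵃ β) ∘ G₂.edge⁻¹

    onEdge-onEdge⁻¹ : ∀ e → onEdge (onEdge⁻¹ e) ≡ e
    onEdge-onEdge⁻¹ e = trans (cong (G₂.edge ∘ moveE α β) (G₁.edge⁻¹-edge (moveE (invᵃ α) (invᵃ β) (G₂.edge⁻¹ e))))
      (trans (cong G₂.edge (moveE-inv α β (G₂.edge⁻¹ e))) (G₂.edge-edge⁻¹ e))

    onEdge⁻¹-onEdge : ∀ e → onEdge⁻¹ (onEdge e) ≡ e
    onEdge⁻¹-onEdge e = trans (cong (G₁.edge ∘ moveE (invᵃ α) (invᵃ β)) (G₂.edge⁻¹-edge (moveE α β (G₁.edge⁻¹ e))))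
      (trans (cong G₁.edge (moveE-inv (invᵃ α) (invᵃ β) (G₁.edge⁻¹ e))) (G₁.edge-edge⁻¹ e))

    -- Pulling back along `onEdge⁻¹` gives the image of the set under `onEdge`.
    twist : EdgeSet H₁ → EdgeSet H₂
    twist = pull onEdge⁻¹

    untwist : EdgeSet H₂ → EdgeSet H₁
    untwist = pull onEdge

    twist-untwist : ∀ A → twist (untwist A) ≡ A
    twist-untwist = pull-pull onEdge onEdge⁻¹ onEdge-onEdge⁻¹

    untwist-twist : ∀ A → untwist (twist A) ≡ A
    untwist-twist = pull-pull onEdge⁻¹ onEdge onEdge⁻¹-onEdge

    size-twist : ∀ A → size H₁ A ≡ size H₂ (twist A)
    size-twist = countF-pull onEdge⁻¹ onEdge onEdge⁻¹-onEdge onEdge-onEdge⁻¹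

    lookup-twist : ∀ A e → lookup (twist A) (G₂.edge e) ≡ lookup A (G₁.edge (moveE (invᵃ α) (invᵃ β) e))
    lookup-twist A e = trans (lookup∘tabulate _ (G₂.edge e))
      (cong (lookup A ∘ G₁.edge ∘ moveE (invᵃ α) (invᵃ β)) (G₂.edge⁻¹-edge e))

    -- Holds because `moveE` fixes the edges of `Y`; it lets a choice made from A ∩ E(Y) be
    -- recovered from the twisted set.
    restrictY-twist : ∀ A → G₂.restrictY (twist A) ≡ G₁.restrictY A
    restrictY-twist A = tabulate-cong (λ e → lookup-twist A (inj₂ (inj₂ e)))

    restrictY-untwist : ∀ A → G₁.restrictY (untwist A) ≡ G₂.restrictY A
    restrictY-untwist A = trans (sym (restrictY-twist (untwist A))) (cong G₂.restrictY (twist-untwist A))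

    θ⁻¹ : ∀ j → ∃ λ i → θ i ≡ j
    θ⁻¹ = inj⇒surj λ {i} {j} e → w-inj (σ-injective β
      (trans (β-w i) (trans (cong w e) (sym (β-w j)))))

    π-inj : Injective _≡_ _≡_ π
    π-inj {i} {j} e = x-inj (σ-injective β (trans (β-x i) (trans (cong x e) (sym (β-x j)))))

    π⁻¹ : Fin r → Fin r
    π⁻¹ = proj₁ ∘ inj⇒surj π-inj

    ππ⁻¹ : ∀ j → π (π⁻¹ j) ≡ j
    ππ⁻¹ = proj₂ ∘ inj⇒surj π-inj

    π⁻¹π : ∀ i → π⁻¹ (π i) ≡ i
    π⁻¹π i = π-inj (ππ⁻¹ (π i))

    module _ (A : EdgeSet H₁) (inv : Invariant Y (G₁.restrictY A) y π) where

      private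
        A′ = G₁.restrictY A
        B₁ = lookup A ∘ G₁.edge
        B₂ = lookup (twist A) ∘ G₂.edge

        inv⁻¹ : Invariant Y A′ y π⁻¹
        inv⁻¹ i j =
          (λ c → proj₂ (inv _ _) (subst₂ (λ i j → Conn Y A′ (y i) (y j)) (sym (ππ⁻¹ i)) (sym (ππ⁻¹ j)) c)) ,
          (λ c → subst₂ (λ i j → Conn Y A′ (y i) (y j)) (ππ⁻¹ i) (ππ⁻¹ j) (proj₁ (inv _ _) c))

        B₁≡A′ : ∀ e → B₁ (inj₂ (inj₂ e)) ≡ lookup A′ e
        B₁≡A′ e = sym (lookup∘tabulate _ e)

        B₂≡A′ : ∀ e → B₂ (inj₂ (inj₂ e)) ≡ lookup A′ e
        B₂≡A′ e = trans (lookup-twist A (inj₂ (inj₂ e))) (B₁≡A′ e)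

        δ   = shift Y A′ y π
        δ⁻¹ = shift Y A′ y π⁻¹
        μ   = move α β δ
        μ⁻¹ = move (invᵃ α) (invᵃ β) δ⁻¹

        μ-Joined : ∀ {p q} → Joined a₁ B₁ p q → Joined a₂ B₂ (μ p) (μ q)
        μ-Joined = move-Joined A′ α β δ
          (λ e → trans (lookup-twist A (moveE α β e))
                       (cong B₁ (moveE-inv (invᵃ α) (invᵃ β) e)))
          B₂≡A′
          (λ i → θ i , α-a i , β-w i)
          (λ i → π i , β-x i , shift-terminal Y A′ y inv i ε)
          (shift-Conn Y A′ y inv)

        μ⁻¹-Joined : ∀ {p q} → Joined a₂ B₂ p q → Joined a₁ B₁ (μ⁻¹ p) (μ⁻¹ q)
        μ⁻¹-Joined = move-Joined A′ (invᵃ α) (invᵃ β) δ⁻¹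
          (λ e → sym (lookup-twist A e))
          B₁≡A′
          onRW⁻¹
          (λ j → π⁻¹ j , back β (trans (β-x _) (cong x (ππ⁻¹ j))) , shift-terminal Y A′ y inv⁻¹ j ε)
          (shift-Conn Y A′ y inv⁻¹)
          where
          back : ∀ {G} (γ : Automorphism G) {u v} → σ γ u ≡ v → σ⁻¹ γ v ≡ u
          back γ refl = σ⁻¹σ γ _

          -- One index `i` serves both equations because `α` and `β` act on the terminals through
          -- the same `θ`.
          onRW⁻¹ : ∀ j → ∃ λ i → σ⁻¹ α (a₂ j) ≡ a₁ i × σ⁻¹ β (w j) ≡ w i
          onRW⁻¹ j with θ⁻¹ j
          ... | i , refl = i , back α (α-a i) , back β (β-w i)

      -- Both `μ` and `μ⁻¹` preserve `Joined`, and they are mutually inverse up to `Joined`; hence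
      -- each also reflects it, and each yields one inequality by `ncomp-≤`.
      ncomp-twist : ncomp H₁ A ≡ ncomp H₂ (twist A)
      ncomp-twist = ≤-antisym
        (ncomp-≤ H₁ A H₂ (twist A) (G₂.ι ∘ μ ∘ G₁.sec) λ u v c →
          subst₂ (Conn H₁ A) (G₁.ι-sec u) (G₁.ι-sec v) (G₁.Joined⇒Conn A
            (closure-sym (back₁ (G₁.sec u)) ◅◅
             μ⁻¹-Joined (G₂.Conn⇒Joined-ι (twist A) (μ (G₁.sec u)) (μ (G₁.sec v)) c) ◅◅ back₁ (G₁.sec v))))
        (ncomp-≤ H₂ (twist A) H₁ A (G₁.ι ∘ μ⁻¹ ∘ G₂.sec) λ u v c →
          subst₂ (Conn H₂ (twist A)) (G₂.ι-sec u) (G₂.ι-sec v) (G₂.Joined⇒Conn (twist A)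
            (closure-sym (back₂ (G₂.sec u)) ◅◅
             μ-Joined (G₁.Conn⇒Joined-ι A (μ⁻¹ (G₂.sec u)) (μ⁻¹ (G₂.sec v)) c) ◅◅ back₂ (G₂.sec v))))
        where
        back₁ : ∀ p → Joined a₁ B₁ (μ⁻¹ (μ p)) p
        back₁ = move-inv A′ B₁≡A′ (invᵃ α) (invᵃ β) (shift-cancel Y A′ y inv⁻¹ π⁻¹π)

        back₂ : ∀ p → Joined a₂ B₂ (μ (μ⁻¹ p)) p
        back₂ = move-inv A′ B₂≡A′ α β (shift-cancel Y A′ y inv ππ⁻¹)

-- Assembly of the bijection and comparison of the Tutte sums

theorem4p2 : (r g : ℕ) → 1 ≤ r → r ≤ 5 → 1 ≤ g →
    (R : Graph) → (u : Fin (r * g) → V R) → Injective _≡_ _≡_ u →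
    Connected R →
    (ψ : Automorphism R) → (∀ i → σ ψ (u i) ≡ u (i +ₘ 1)) →
    (W₀ : Graph) → Loopless W₀ →
    (w : Fin (r * g) → V W₀) → Injective _≡_ _≡_ w →
    (x : Fin r → V W₀) → Injective _≡_ _≡_ x →
    (∀ i j → w i ≡ x j → ⊥) →
    (φ : Automorphism W₀) →
    (∀ i → σ φ (w i) ≡ w (i +ₘ g)) →
    (∀ i → σ φ (x i) ≡ x (i +ₘ 1)) →
    (ρ : Automorphism W₀) →
    (∃ λ c → ∀ s → σ ρ (w s) ≡ w (reflectₘ c s)) →
    (∃ λ c' → ∀ s → σ ρ (x s) ≡ x (reflectₘ c' s)) →
    (Y : Graph) → (y : Fin r → V Y) → Injective _≡_ _≡_ y →
    (W : Graph) → (gW : IsGluing W₀ r x Y y W) →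
    (H₁ : Graph) → IsGluing R (r * g) u W (IsGluing.ιG gW ∘ w) H₁ →
    (H₂ : Graph) → IsGluing R (r * g) (u ∘ opposite) W (IsGluing.ιG gW ∘ w) H₂ →
    TEquivalent H₁ H₂
-- With both factors successors, `r * g` reduces to a successor, the form in which the cyclic index
-- operations compute.
theorem4p2 (suc r-1) (suc g-1) _ r≤5 _ R u _ _ ψ ψ-u W₀ _ w w-inj x x-inj w≢x φ φ-w φ-x
           ρ (c , ρ-w) (d , ρ-x) Y y _ W gW H₁ g₁ H₂ g₂ i j = begin
  tutte H₁ i j                     ≡⟨ sumSub-cong (nE H₁) term-twist ⟩
  sumSub (nE H₁) (term H₂ ∘ twist) ≡⟨ sumSub-reindex twist untwist twist-untwist untwist-twist (term H₂) ⟩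
  tutte H₂ i j                     ∎
  where
  open ≡-Reasoning
  r g : ℕ
  r = suc r-1
  g = suc g-1

  term : (G : Graph) → EdgeSet G → ℤ
  term G A = coeffPow (ncomp G A ∸ ncomp G (fullE G)) i ℤ.* coeffPow ((size G A + ncomp G A) ∸ nV G) j

  open Pieces R W₀ Y w x y using (module Glued; module Twist)
  module G₁ = Glued gW w≢x u g₁
  module G₂ = Glued gW w≢x (u ∘ opposite) g₂

  reflection : (A : EdgeSet Y) → ∃ λ (t : Fin r) → Invariant Y A y (λ s → reflectₘ d s +ₘ toℕ t)
  reflection A = invariant-reflection Y A y r≤5 d

  -- Since `φᵗ` shifts the `x i` by t but the `w i` by t·g, the reflection of the `w i` has shift
  -- t·g, and `turn` gives the matching exponent of `ψ`.
  module T (t : Fin r) = Twist gW w≢x w-inj x-inj g₁ g₂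
    (powᵃ ψ (turn c (toℕ t * g))) (powᵃ φ (toℕ t) ∘ᵃ ρ)
    (λ s → reflectₘ c s +ₘ (toℕ t * g)) (λ s → reflectₘ d s +ₘ toℕ t)
    (λ s → trans (pow-shift ψ u 1 ψ-u (turn c (toℕ t * g)) s)
      (cong u (trans (cong (s +ₘ_) (*-identityʳ (turn c (toℕ t * g)))) (turn-opposite c (toℕ t * g) s))))
    (λ s → trans (cong (σ (powᵃ φ (toℕ t))) (ρ-w s)) (pow-shift φ w g φ-w (toℕ t) (reflectₘ c s)))
    (λ s → trans (cong (σ (powᵃ φ (toℕ t))) (ρ-x s))
      (trans (pow-shift φ x 1 φ-x (toℕ t) (reflectₘ d s))
        (cong (λ m → x (reflectₘ d s +ₘ m)) (*-identityʳ (toℕ t)))))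

  amount : EdgeSet Y → Fin r
  amount = proj₁ ∘ reflection

  -- The twist depends on A only through A ∩ E(Y), which it preserves.
  twist : EdgeSet H₁ → EdgeSet H₂
  twist A = T.twist (amount (G₁.restrictY A)) A

  untwist : EdgeSet H₂ → EdgeSet H₁
  untwist A = T.untwist (amount (G₂.restrictY A)) A

  -- Both maps select the same `t`, because untwisting keeps A ∩ E(Y); the inverse law for that
  -- fixed `t` then applies.
  twist-untwist : ∀ A → twist (untwist A) ≡ A
  twist-untwist A = trans
    (cong (λ B → T.twist (amount B) (untwist A)) (T.restrictY-untwist (amount (G₂.restrictY A)) A))
    (T.twist-untwist (amount (G₂.restrictY A)) A)

  untwist-twist : ∀ A → untwist (twist A) ≡ A
  untwist-twist A = trans
    (cong (λ B → T.untwist (amount B) (twist A)) (T.restrictY-twist (amount (G₁.restrictY A)) A))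
    (T.untwist-twist (amount (G₁.restrictY A)) A)

  ncomp-twist : ∀ A → ncomp H₁ A ≡ ncomp H₂ (twist A)
  ncomp-twist A = let t , inv = reflection (G₁.restrictY A) in T.ncomp-twist t A inv

  -- The twist of the full edge set is full, which matches the c(E) in the exponent of x-1.
  ncomp-full : ncomp H₁ (fullE H₁) ≡ ncomp H₂ (fullE H₂)
  ncomp-full = trans (ncomp-twist (fullE H₁))
    (cong (ncomp H₂) (pull-replicate (T.onEdge⁻¹ (amount (G₁.restrictY (fullE H₁)))) true))

  nV-equal : nV H₁ ≡ nV H₂
  nV-equal = ≤-antisym (nV-≤ g₁ g₂ λ s → opposite s , refl)
    (nV-≤ g₂ g₁ λ s → opposite s , cong u (sym (opposite-involutive s)))

  term-twist : ∀ A → term H₁ A ≡ term H₂ (twist A)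
  term-twist A = cong₂ (λ m n → coeffPow m i ℤ.* coeffPow n j)
    (cong₂ _∸_ (ncomp-twist A) ncomp-full)
    (cong₂ _∸_ (cong₂ _+_ (T.size-twist (amount (G₁.restrictY A)) A) (ncomp-twist A)) nV-equal)
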